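{- Let $\Sigma$ be a finite alphabet, $w$ a positive integer, and $\tau=(R_1,\dots,R_m)$ a relational vocabulary. Given a monadic second-order sentence $\psi$ over the vocabulary of strings over the alphabet $\mathcal{B}(\Sigma,w,\tau)$ and a first-order sentence $\varphi$ over $\tau$, one can decide whether there exists a string $D_0\otimes D_1\otimes\cdots\otimes D_m\in\mathcal{B}(\Sigma,w,\tau)^{\circledast}$ such that $D_0\otimes\cdots\otimes D_m\models\psi$ and $\mathcal{S}(D_0,\dots,D_m)\models\varphi$.
   Context: Padding and tensor products. Fix a padding symbol $\#$ not in any alphabet considered. For alphabets $\Gamma_1,\dots,\Gamma_a$, $\Gamma_1\otimes\cdots\otimes\Gamma_a$ is the Cartesian product regarded as an alphabet, and $\Gamma^{\otimes a}$ its $a$-fold power. For nonempty strings $u_i$ over $\Gamma_i$ of lengths $n_i$, $u_1\otimes\cdots\otimes u_a$ is the string of length $\max_i n_i$ whose $j$-th symbol is the tuple of $j$-th symbols of the $u_i$, with $\#$ in place of missing symbols. For languages, $L_1\otimes\cdots\otimes L_a=\{u_1\otimes\cdots\otimes u_a:u_i\in L_i\}$ and $L^{\otimes a}$ is the $a$-fold product. For a language $L$ over a tensor alphabet, $\mathcal{R}(L)=\{(u_1,\dots,u_a):u_1\otimes\cdots\otimes u_a\in L\}$. ODDs. For an alphabet $\Sigma$ and $w\ge1$, a $(\Sigma,w)$-layer is a tuple $B=(\ell,r,T,I,F,\iota,\phi)$ with $\ell,r\subseteq\{0,\dots,w-1\}$, $T\subseteq\ell\times(\Sigma\sqcup\{\#\})\times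 r$, $I\subseteq\ell$, $F\subseteq r$, $\iota,\phi$ Booleans, $I=\emptyset$ if $\iota$ is false and $F=\emptyset$ if $\phi$ is false. $\mathcal{B}(\Sigma,w)$ is the finite set of such layers, an alphabet. A $(\Sigma,w)$-ODD of length $k$ is a string $B_1\cdots B_k$ over $\mathcal{B}(\Sigma,w)$ with $\ell(B_{i+1})=r(B_i)$, $\iota(B_i)$ true iff $i=1$, $\phi(B_i)$ true iff $i=k$; $\mathcal{B}(\Sigma,w,k)$ is the set of them. A nonempty string $\sigma_1\cdots\sigma_{k'}$ over $\Sigma$, $k'\le k$, is accepted if, padding it with $\#$ to length $k$ (symbols $\hat\sigma_i$), there are $(p_i,\hat\sigma_i,q_i)\in T(B_i)$ with $p_{i+1}=q_i$, $p_1\in I(B_1)$, $q_k\in F(B_k)$; $L(D)$ is the set of accepted strings. Structural tuples. $\tau=(R_1,\dots,R_m)$ has arities $a_i$. A tuple $(D_0,\dots,D_m)$ is $(\Sigma,w,\tau)$-structural if for some $k\ge1$, $D_0\in\mathcal{B}(\Sigma,w,k)$, $D_i\in\mathcal{B}(\Sigma^{\otimes a_i},w,k)$ and $L(D_i)\subseteq L(D_0)^{\otimes a_i}$ for $i\in[m]$; its derived structure $\mathcal{S}(D_0,\dots,D_m)$ is the $\tau$-structure with domain $L(D_0)$ interpreting $R_i$ as $\mathcal{R}(L(D_i))$. Let $\mathcal{B}(\Sigma,w,\tau)=\mathcal{B}(\Sigma,w)\otimes\mathcal{B}(\Sigma^{\otimes a_1},w)\otimes\cdots\otimes\mathcal{B}(\Sigma^{\otimes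 a_m},w)$, and let $\mathcal{B}(\Sigma,w,\tau)^{\circledast}$ be the set of strings $D_0\otimes\cdots\otimes D_m$ over $\mathcal{B}(\Sigma,w,\tau)$ such that $(D_0,\dots,D_m)$ is $(\Sigma,w,\tau)$-structural. Strings over an alphabet $\Gamma$ are viewed as logical structures over the standard vocabulary of $\Gamma$-strings (positions, their linear order, and a unary predicate for each letter of $\Gamma$), which is the setting for monadic second-order sentences over strings. -}

module Defs where

open import Data.Nat using (ℕ; zero; suc; _≤_; _<_; _⊔_)
open import Data.Bool using (Bool; true; false)
open import Data.Fin using (Fin; zero; suc; inject₁; fromℕ; toℕ) renaming (_<_ to _<ᶠ_)
open import Data.Fin.Subset using (Subset; _∈_; _⊆_) renaming (⊥ to ∅)
open import Data.Maybe using (Maybe; just; nothing)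
open import Data.List using (List; []; _∷_; length; upTo; foldr; allFin) renaming (map to mapL)
open import Data.Vec using (Vec; lookup; tabulate; head; last) renaming (map to mapV)
open import Data.Product using (Σ; ∃; _×_; _,_; proj₁; proj₂)
open import Data.Sum using (_⊎_)
open import Data.Empty using (⊥)
open import Relation.Nullary using (¬_)
open import Relation.Binary.PropositionalEquality using (_≡_; _≢_)

-- Strings, padding and tensor products
-- A finite alphabet Σ is represented by Fin s.  The padding symbol # is
-- represented by `nothing` (Maybe A = A ⊔ {#}).

at : {A : Set} → List A → ℕ → Maybe A
at []       _       = nothing
at (x ∷ xs) zero    = just x
at (x ∷ xs) (suc j) = at xs j

TLetter : Set → ℕ → Set
TLetter A a = Vec (Maybe A) a

maxLen : {A : Set} {a : ℕ} → (Fin a → List A) → ℕ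
maxLen {a = a} us = foldr _⊔_ 0 (mapL (λ i → length (us i)) (allFin a))

tensor : {A : Set} {a : ℕ} → (Fin a → List A) → List (TLetter A a)
tensor us = mapL (λ j → tabulate (λ i → at (us i) j)) (upTo (maxLen us))

InTensorPow : {A : Set} → (List A → Set) → (a : ℕ) → List (TLetter A a) → Set
InTensorPow {A} L a u =
  Σ (Fin a → List A) λ us → ((i : Fin a) → L (us i)) × (u ≡ tensor us)

record Layer (A : Set) (w : ℕ) : Set where
  field
    ℓ  : Subset w
    r  : Subset w
    T  : Fin w → Maybe A → Fin w → Bool
    I  : Subset w
    F  : Subset w
    ι  : Bool
    φ  : Bool
    T⊆ : ∀ p c q → T p c q ≡ true → (p ∈ ℓ) × (q ∈ r)
    I⊆ : I ⊆ ℓ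
    F⊆ : F ⊆ r
    ιI : ι ≡ false → I ≡ ∅
    φF : φ ≡ false → F ≡ ∅
open Layer public

-- equality of layers as mathematical objects (the proof fields are
-- irrelevant and T is a set, so compared pointwise)
_≈L_ : {A : Set} {w : ℕ} → Layer A w → Layer A w → Set
B ≈L B' = (ℓ B ≡ ℓ B') × (r B ≡ r B') × (∀ p c q → T B p c q ≡ T B' p c q)
        × (I B ≡ I B') × (F B ≡ F B') × (ι B ≡ ι B') × (φ B ≡ φ B')

-- ODDs: D = B₁ ⋯ B_k, k ≥ 1, represented as Vec (Layer A w) (suc k)

IsODD : {A : Set} {w k : ℕ} → Vec (Layer A w) (suc k) → Set
IsODD {k = k} D =
    ((j : Fin k) → r (lookup D (inject₁ j)) ≡ ℓ (lookup D (suc j)))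
  × ((j : Fin (suc k)) → (ι (lookup D j) ≡ true → j ≡ zero) × (j ≡ zero → ι (lookup D j) ≡ true))
  × ((j : Fin (suc k)) → (φ (lookup D j) ≡ true → j ≡ fromℕ k) × (j ≡ fromℕ k → φ (lookup D j) ≡ true))

Accepts : {A : Set} {w k : ℕ} → Vec (Layer A w) (suc k) → List A → Set
Accepts {w = w} {k = k} D u =
    (u ≢ []) × (length u ≤ suc k)
  × Σ (Fin (suc (suc k)) → Fin w) λ st →
      ((j : Fin (suc k)) → T (lookup D j) (st (inject₁ j)) (at u (toℕ j)) (st (suc j)) ≡ true)
    × (st zero ∈ I (head D))
    × (st (fromℕ (suc k)) ∈ F (last D))

-- The alphabet B(Σ,w,τ) with Σ = Fin s and τ given by its arity vector

BLetter : (s w : ℕ) {m : ℕ} → Vec ℕ m → Set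
BLetter s w {m} τ = Layer (Fin s) w × ((i : Fin m) → Layer (TLetter (Fin s) (lookup τ i)) w)

_≈B_ : {s w m : ℕ} {τ : Vec ℕ m} → BLetter s w τ → BLetter s w τ → Set
x ≈B y = (proj₁ x ≈L proj₁ y) × (∀ i → proj₂ x i ≈L proj₂ y i)

comp₀ : {s w m k : ℕ} {τ : Vec ℕ m} → Vec (BLetter s w τ) k → Vec (Layer (Fin s) w) k
comp₀ = mapV proj₁

compᵢ : {s w m k : ℕ} {τ : Vec ℕ m} → Vec (BLetter s w τ) k → (i : Fin m)
      → Vec (Layer (TLetter (Fin s) (lookup τ i)) w) k
compᵢ {τ = τ} D i = mapV (λ x → proj₂ x i) D

Structural : {s w m k : ℕ} (τ : Vec ℕ m) → Vec (BLetter s w τ) (suc k) → Set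
Structural {m = m} τ D =
    IsODD (comp₀ {τ = τ} D)
  × ((i : Fin m) → IsODD (compᵢ {τ = τ} D i))
  × ((i : Fin m) → ∀ u → Accepts (compᵢ {τ = τ} D i) u → InTensorPow (Accepts (comp₀ {τ = τ} D)) (lookup τ i) u)

record Structure {m : ℕ} (τ : Vec ℕ m) : Set₁ where
  field
    Dom  : Set
    _≈D_ : Dom → Dom → Set
    Rel  : (i : Fin m) → (Fin (lookup τ i) → Dom) → Set
open Structure public

data FO {m : ℕ} (τ : Vec ℕ m) : ℕ → Set where
  rel  : ∀ {n} (i : Fin m) → (Fin (lookup τ i) → Fin n) → FO τ n
  eq   : ∀ {n} → Fin n → Fin n → FO τ n
  neg  : ∀ {n} → FO τ n → FO τ n
  and  : ∀ {n} → FO τ n → FO τ n → FO τ n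
  or   : ∀ {n} → FO τ n → FO τ n → FO τ n
  ex   : ∀ {n} → FO τ (suc n) → FO τ n
  all  : ∀ {n} → FO τ (suc n) → FO τ n

extend : {X : Set} {n : ℕ} → X → (Fin n → X) → Fin (suc n) → X
extend x ρ zero    = x
extend x ρ (suc i) = ρ i

SatFO : {m : ℕ} {τ : Vec ℕ m} (𝔄 : Structure τ) {n : ℕ} → (Fin n → Dom 𝔄) → FO τ n → Set
SatFO 𝔄 ρ (rel i xs) = Rel 𝔄 i (λ j → ρ (xs j))
SatFO 𝔄 ρ (eq x y)   = _≈D_ 𝔄 (ρ x) (ρ y)
SatFO 𝔄 ρ (neg f)    = ¬ SatFO 𝔄 ρ f
SatFO 𝔄 ρ (and f g)  = SatFO 𝔄 ρ f × SatFO 𝔄 ρ g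
SatFO 𝔄 ρ (or f g)   = SatFO 𝔄 ρ f ⊎ SatFO 𝔄 ρ g
SatFO 𝔄 ρ (ex f)     = Σ (Dom 𝔄) λ d → SatFO 𝔄 (extend d ρ) f
SatFO 𝔄 ρ (all f)    = (d : Dom 𝔄) → SatFO 𝔄 (extend d ρ) f

_⊨FO_ : {m : ℕ} {τ : Vec ℕ m} → Structure τ → FO τ 0 → Set
𝔄 ⊨FO φ = SatFO 𝔄 (λ ()) φ

data MSO (Γ : Set) : ℕ → ℕ → Set where
  letter : ∀ {n m} → Γ → Fin n → MSO Γ n m
  less   : ∀ {n m} → Fin n → Fin n → MSO Γ n m
  equal  : ∀ {n m} → Fin n → Fin n → MSO Γ n m
  mem    : ∀ {n m} → Fin n → Fin m → MSO Γ n m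
  neg    : ∀ {n m} → MSO Γ n m → MSO Γ n m
  and    : ∀ {n m} → MSO Γ n m → MSO Γ n m → MSO Γ n m
  or     : ∀ {n m} → MSO Γ n m → MSO Γ n m → MSO Γ n m
  ex₁    : ∀ {n m} → MSO Γ (suc n) m → MSO Γ n m
  all₁   : ∀ {n m} → MSO Γ (suc n) m → MSO Γ n m
  ex₂    : ∀ {n m} → MSO Γ n (suc m) → MSO Γ n m
  all₂   : ∀ {n m} → MSO Γ n (suc m) → MSO Γ n m

SatMSO : {Γ : Set} (_≈_ : Γ → Γ → Set) {k n m : ℕ} (x : Vec Γ k)
       → (Fin n → Fin k) → (Fin m → Subset k) → MSO Γ n m → Set
SatMSO _≈_ x ρ σ (letter b i) = lookup x (ρ i) ≈ b
SatMSO _≈_ x ρ σ (less i j)   = ρ i <ᶠ ρ j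
SatMSO _≈_ x ρ σ (equal i j)  = ρ i ≡ ρ j
SatMSO _≈_ x ρ σ (mem i X)    = ρ i ∈ σ X
SatMSO _≈_ x ρ σ (neg f)      = ¬ SatMSO _≈_ x ρ σ f
SatMSO _≈_ x ρ σ (and f g)    = SatMSO _≈_ x ρ σ f × SatMSO _≈_ x ρ σ g
SatMSO _≈_ x ρ σ (or f g)     = SatMSO _≈_ x ρ σ f ⊎ SatMSO _≈_ x ρ σ g
SatMSO _≈_ {k} x ρ σ (ex₁ f)  = Σ (Fin k) λ p → SatMSO _≈_ x (extend p ρ) σ f
SatMSO _≈_ {k} x ρ σ (all₁ f) = (p : Fin k) → SatMSO _≈_ x (extend p ρ) σ f
SatMSO _≈_ {k} x ρ σ (ex₂ f)  = Σ (Subset k) λ P → SatMSO _≈_ x ρ (extend P σ) f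
SatMSO _≈_ {k} x ρ σ (all₂ f) = (P : Subset k) → SatMSO _≈_ x ρ (extend P σ) f

Models-MSO : {s w m k : ℕ} (τ : Vec ℕ m) → Vec (BLetter s w τ) k → MSO (BLetter s w τ) 0 0 → Set
Models-MSO τ x ψ = SatMSO (_≈B_ {τ = τ}) x (λ ()) (λ ()) ψ

DerivedStructure : {s w m k : ℕ} (τ : Vec ℕ m) → Vec (BLetter s w τ) (suc k) → Structure τ
DerivedStructure {s = s} τ D = record
  { Dom  = Σ (List (Fin s)) (Accepts (comp₀ {τ = τ} D))
  ; _≈D_ = λ u v → proj₁ u ≡ proj₁ v
  ; Rel  = λ i xs → Accepts (compᵢ {τ = τ} D i) (tensor (λ j → proj₁ (xs j)))
  }

{-# OPTIONS --safe #-}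
-- Every first-order or monadic second-order property involved is recognised by
-- a finite automaton reading D₀ ⊗ ⋯ ⊗ D_m, with one extra track per free
-- variable: a position or a set of positions is written as its characteristic
-- function, an element of the derived structure as its padded string.
-- Connectives are handled by product and complement, quantifiers by projecting
-- a track away once the tracks that encode a value have been recognised.
-- Acceptance by an ODD is itself such a projection (guess the states), and
-- L(Dᵢ) ⊆ L(D₀)^⊗a quantifies over padded strings over the tensor alphabet.
-- Nonemptiness of the resulting automaton is reachability in a finite graph.
module Submission where

open import Defs
open import Data.Bool using (Bool; true; false; not; _∧_; _∨_) renaming (T to So; _≟_ to _≟ᵇ_)
open import Data.Bool.Properties using (T-∧; T-∨; T-≡; T?)
open import Data.Empty using (⊥)
open import Data.Fin using (Fin; zero; suc; toℕ; inject₁; fromℕ; combine; remQuot) renaming (_<_ to _<ᶠ_)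
open import Data.Fin.Properties using (any?; all?; remQuot-combine; toℕ<n; toℕ-injective; fromℕ≢inject₁; <-irrefl; <-cmp) renaming (_≟_ to _≟ᶠ_)
open import Data.Fin.Subset using (Subset; _∈_; _⊆_) renaming (⊥ to ∅)
open import Data.Fin.Subset.Properties using (_∈?_; _⊆?_)
open import Data.List using (List; []; _∷_; length; foldr; applyUpTo) renaming (tabulate to tabulateL)
open import Data.List.Properties using (map-upTo; length-applyUpTo; map-tabulate)
open import Data.Maybe using (Maybe; just; nothing; maybe; is-just; is-nothing)
open import Data.Nat using (ℕ; zero; suc; _*_; _≤_; _<_; _⊔_; z≤n; s≤s; s≤s⁻¹)
open import Data.Nat.Properties using (m<1+n⇒m<n∨m≡n; ⊔-lub; m⊔n≤o⇒m≤o; m⊔n≤o⇒n≤o; ≤-trans; <⇒≤; ≰⇒>) renaming (_≟_ to _≟ℕ_)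
open import Data.Product using (Σ; _×_; _,_; proj₁; proj₂)
open import Data.Product.Function.NonDependent.Propositional using (_×-⇔_)
open import Data.Sum using (_⊎_; inj₁; inj₂)
open import Data.Sum.Function.Propositional using (_⊎-⇔_)
open import Data.Unit using (tt)
open import Data.Vec using (Vec; []; _∷_; lookup; tabulate; head; last)
open import Data.Vec.Properties using (lookup∘tabulate; tabulate-cong; lookup-map; []=⇒lookup; lookup⇒[]=)
open import Function using (_∘_; _⇔_; mk⇔; Equivalence; id; case_of_)
open import Function.Construct.Composition using (_⇔-∘_)
open import Function.Construct.Symmetry using (⇔-sym)
open import Relation.Binary.Construct.Closure.Transitive using (TransClosure; [_]; _∷_; _∷ʳ_; _++_)
open import Relation.Binary.Definitions using (tri<; tri≈; tri>)
open import Relation.Binary.PropositionalEquality using (_≡_; _≢_; _≗_; refl; sym; trans; cong; cong₂; subst)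
open import Relation.Binary.Structures using (IsDecEquivalence)
open import Relation.Nullary using (¬_; Dec; yes; no; contradiction)
open import Relation.Nullary.Decidable using (⌊_⌋; toWitness; fromWitness; map′; _×-dec_; _⊎-dec_; _→-dec_; isYes≗does; does-⇔; decidable-stable) renaming (map to map-Dec)

open Equivalence using (to; from)

-- Finite types

-- Layers contain functions and proof fields, so letters are compared by an equivalence instead of
-- `_≡_`. Finiteness is asked of states and of track symbols, never of the layers themselves:
-- automaton steps must respect the equivalence, and the search for a letter is carried out up to
-- it. Tracks can contain junk: a Boolean track need not mark exactly one position, a track of
-- symbols need not spell an accepted string. Each kind of quantified value therefore comes with an
-- automaton recognising the tracks of genuine values. Tracks can represent the elements of a
-- derived structure because all ODDs of a tuple have the same length: an accepted string never has
-- more symbols than the word has positions. The delicate point is padding in tensor products. A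
-- tuple of padding symbols is a letter of the tensor alphabet and differs from that alphabet's own
-- padding symbol, so a string is not determined by its components until such tuples are excluded.

record Finite (A : Set) : Set where
  field
    size       : ℕ
    index      : A → Fin size
    elem       : Fin size → A
    -- A retraction is enough: every element is hit by `elem`, which makes exhaustive search
    -- complete, and `index` is injective, which decides equality. Codes may be redundant.
    elem-index : ∀ a → elem (index a) ≡ a

  index-injective : ∀ {a b} → index a ≡ index b → a ≡ b
  index-injective {a} {b} p = trans (sym (elem-index a)) (trans (cong elem p) (elem-index b))

  infix 4 _≟_
  _≟_ : (a b : A) → Dec (a ≡ b)
  a ≟ b = map′ index-injective (cong index) (index a ≟ᶠ index b)

  exists? : {P : A → Set} → (∀ a → Dec (P a)) → Dec (Σ A P)
  exists? {P} P? = map′ (λ (i , p) → elem i , p)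
                        (λ (a , p) → index a , subst P (sym (elem-index a)) p)
                        (any? (P? ∘ elem))

  forall? : {P : A → Set} → (∀ a → Dec (P a)) → Dec (∀ a → P a)
  forall? {P} P? = map′ (λ f a → subst P (elem-index a) (f (index a))) (λ f i → f (elem i))
                        (all? (P? ∘ elem))
open Finite

finite-retract : {A B : Set} (f : A → B) (g : B → A) → (∀ a → g (f a) ≡ a) → Finite B → Finite A
finite-retract f g gf B = record
  { size = size B ; index = index B ∘ f ; elem = g ∘ elem B
  ; elem-index = λ a → trans (cong g (elem-index B (f a))) (gf a) }

finite-Fin : ∀ n → Finite (Fin n)
finite-Fin n = record { size = n ; index = id ; elem = id ; elem-index = λ _ → refl }

finite-Bool : Finite Bool
finite-Bool = finite-retract f g (λ { true → refl ; false → refl }) (finite-Fin 2)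
  where
  f : Bool → Fin 2
  f false = zero
  f true  = suc zero
  g : Fin 2 → Bool
  g zero    = false
  g (suc _) = true

finite-× : {A B : Set} → Finite A → Finite B → Finite (A × B)
finite-× A B = record
  { size = size A * size B
  ; index = λ (a , b) → combine (index A a) (index B b)
  ; elem = λ i → elem A (proj₁ (remQuot (size B) i)) , elem B (proj₂ (remQuot {size A} (size B) i))
  ; elem-index = λ (a , b) → trans
      (cong (λ (i , j) → elem A i , elem B j) (remQuot-combine (index A a) (index B b)))
      (cong₂ _,_ (elem-index A a) (elem-index B b)) }

finite-Maybe : {A : Set} → Finite A → Finite (Maybe A)
finite-Maybe {A} fin = record
  { size = suc (size fin) ; index = f ; elem = g
  ; elem-index = λ { nothing → refl ; (just a) → cong just (elem-index fin a) } }
  where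
  f : Maybe A → Fin (suc (size fin))
  f nothing  = zero
  f (just a) = suc (index fin a)
  g : Fin (suc (size fin)) → Maybe A
  g zero    = nothing
  g (suc i) = just (elem fin i)

finite-Vec : {A : Set} → Finite A → ∀ n → Finite (Vec A n)
finite-Vec A zero    = finite-retract (λ _ → zero) (λ _ → []) (λ { [] → refl }) (finite-Fin 1)
finite-Vec A (suc n) = finite-retract (λ { (a ∷ v) → a , v }) (λ (a , v) → a ∷ v)
                                      (λ { (_ ∷ _) → refl }) (finite-× A (finite-Vec A n))

⌊⌋-cong : {A B : Set} → A ⇔ B → (a? : Dec A) (b? : Dec B) → ⌊ a? ⌋ ≡ ⌊ b? ⌋
⌊⌋-cong A⇔B a? b? = trans (isYes≗does a?) (trans (does-⇔ A⇔B a? b?) (sym (isYes≗does b?)))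

So-⌊⌋ : {A : Set} (a? : Dec A) → So ⌊ a? ⌋ ⇔ A
So-⌊⌋ a? = mk⇔ (toWitness {a? = a?}) (fromWitness {a? = a?})

So-not : ∀ b → So (not b) ⇔ (¬ So b)
So-not false = mk⇔ (λ _ ()) (λ _ → tt)
So-not true  = mk⇔ (λ ()) (λ f → f tt)

≡⇒⇔ : {A B : Set} → A ≡ B → A ⇔ B
≡⇒⇔ refl = mk⇔ id id

-- Decidability of the transitive closure

-- Warshall's algorithm: Via i p q says that q can be reached from p through
-- intermediate points of index below i.
module _ {A : Set} (fin : Finite A) (_⟶_ : A → A → Set) (_⟶?_ : ∀ p q → Dec (p ⟶ q)) where

  Via : ℕ → A → A → Set
  Via zero    p q = p ⟶ q
  Via (suc i) p q = Via i p q ⊎ Σ A λ m → toℕ (index fin m) ≡ i × Via i p m × Via i m q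

  via? : ∀ i p q → Dec (Via i p q)
  via? zero    p q = p ⟶? q
  via? (suc i) p q = via? i p q ⊎-dec
    exists? fin λ m → (toℕ (index fin m) ≟ℕ i) ×-dec via? i p m ×-dec via? i m q

  via-sound : ∀ i {p q} → Via i p q → TransClosure _⟶_ p q
  via-sound zero    x = [ x ]
  via-sound (suc i) (inj₁ x) = via-sound i x
  via-sound (suc i) (inj₂ (_ , _ , x , y)) = via-sound i x ++ via-sound i y

  via-edge : ∀ i {p q} → p ⟶ q → Via i p q
  via-edge zero    x = x
  via-edge (suc i) x = inj₁ (via-edge i x)

  same-index : ∀ {m n i} → toℕ (index fin m) ≡ i → toℕ (index fin n) ≡ i → m ≡ n
  same-index a b = index-injective fin (toℕ-injective (trans a (sym b)))

  -- If both halves already pass through the point of index `i - 1`, it is the same point, and the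
  -- loop between the two visits is cut out. The same cut applies when `m` is itself that point and
  -- recurs in one half.
  via-trans : ∀ i {p m q} → toℕ (index fin m) < i → Via i p m → Via i m q → Via i p q
  via-trans (suc i) {m = m} lt x y with m<1+n⇒m<n∨m≡n lt
  via-trans (suc i) lt (inj₁ x) (inj₁ y) | inj₁ l = inj₁ (via-trans i l x y)
  via-trans (suc i) lt (inj₁ x) (inj₁ y) | inj₂ e = inj₂ (_ , e , x , y)
  via-trans (suc i) lt (inj₁ x) (inj₂ (n , e , y , z)) | inj₁ l = inj₂ (n , e , via-trans i l x y , z)
  via-trans (suc i) lt (inj₁ x) (inj₂ (n , e , y , z)) | inj₂ e′ with refl ← same-index e e′ =
    inj₂ (n , e , x , z)
  via-trans (suc i) lt (inj₂ (n , e , x , y)) (inj₁ z) | inj₁ l = inj₂ (n , e , x , via-trans i l y z)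
  via-trans (suc i) lt (inj₂ (n , e , x , y)) (inj₁ z) | inj₂ e′ with refl ← same-index e e′ =
    inj₂ (n , e , x , z)
  via-trans (suc i) lt (inj₂ (n , e , x , _)) (inj₂ (n′ , e′ , _ , z)) | _ with refl ← same-index e e′ =
    inj₂ (n , e , x , z)

  via-complete : ∀ {p q} → TransClosure _⟶_ p q → Via (size fin) p q
  via-complete [ x ]    = via-edge (size fin) x
  via-complete (_∷_ {y = y} x xs) =
    via-trans (size fin) (toℕ<n (index fin y)) (via-edge (size fin) x) (via-complete xs)

  transClosure? : ∀ p q → Dec (TransClosure _⟶_ p q)
  transClosure? p q = map′ (via-sound (size fin)) via-complete (via? (size fin) p q)

-- Automata

foldWord : {A S : Set} → (A → S → S) → S → ∀ {n} → (Fin n → A) → S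
foldWord f s {zero}  w = s
foldWord f s {suc n} w = f (w zero) (foldWord f s (w ∘ suc))

-- Words are read from right to left, so that a run is a right fold. Letters
-- may carry functions and proofs, whence the relation respected by the steps.
record Automaton {A : Set} (_≈_ : A → A → Set) : Set₁ where
  field
    State      : Set
    finite     : Finite State
    start      : State
    step       : A → State → State
    step-resp  : ∀ {a b} q → a ≈ b → step a q ≡ step b q
    final      : State → Bool

  run : ∀ {n} → (Fin n → A) → State
  run = foldWord step start

  Accepted : ∀ {n} → (Fin n → A) → Set
  Accepted w = So (final (run w))

  run-cong : ∀ {n} {v w : Fin n → A} → (∀ j → v j ≈ w j) → run v ≡ run w
  run-cong {zero}  e = refl
  run-cong {suc n} {v} {w} e =
    trans (step-resp (run (v ∘ suc)) (e zero)) (cong (step (w zero)) (run-cong (e ∘ suc)))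
open Automaton

-- A family of environments, each over a nonempty set of positions 0, …, k and
-- written as a word with one letter per position.
record Coding : Set₁ where
  field
    Env    : ℕ → Set
    Letter : Set
    _≈_    : Letter → Letter → Set
    word   : ∀ {k} → Env k → Fin (suc k) → Letter
open Coding

record Recognisable (W : Coding) (P : ∀ k → Env W k → Set) : Set₁ where
  field
    automaton : Automaton (_≈_ W)
    correct   : ∀ {k} (e : Env W k) → P k e ⇔ Accepted automaton (word W e)

  dec : ∀ {k} (e : Env W k) → Dec (P k e)
  dec e = map-Dec (⇔-sym (correct e)) (T? _)
open Recognisable

module _ {W : Coding} where

  rec-⇔ : ∀ {P Q} → Recognisable W P → (∀ k e → P k e ⇔ Q k e) → Recognisable W Q
  rec-⇔ R PQ = record { automaton = automaton R ; correct = λ e → correct R e ⇔-∘ ⇔-sym (PQ _ e) }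

  rec-¬ : ∀ {P} → Recognisable W P → Recognisable W (λ k e → ¬ P k e)
  rec-¬ R = record
    { automaton = record
        { State = State M ; finite = finite M ; start = start M ; step = step M
        ; step-resp = step-resp M ; final = not ∘ final M }
    ; correct = λ e → mk⇔
        (λ ¬p → from (So-not _) (¬p ∘ from (correct R e)))
        (λ a → to (So-not _) a ∘ to (correct R e)) }
    where M = automaton R

  product : (Bool → Bool → Bool) → (M N : Automaton (_≈_ W)) → Automaton (_≈_ W)
  product op M N = record
    { State = State M × State N ; finite = finite-× (finite M) (finite N)
    ; start = start M , start N ; step = λ a (p , q) → step M a p , step N a q
    ; step-resp = λ (p , q) e → cong₂ _,_ (step-resp M p e) (step-resp N q e)
    ; final = λ (p , q) → op (final M p) (final N q) }

  run-product : ∀ op M N {n} (w : Fin n → Letter W) → run (product op M N) w ≡ (run M w , run N w)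
  run-product op M N {zero}  w = refl
  run-product op M N {suc n} w = cong (step (product op M N) (w zero)) (run-product op M N (w ∘ suc))

  accepted-product : ∀ op M N {n} (w : Fin n → Letter W) →
    So (op (final M (run M w)) (final N (run N w))) ⇔ Accepted (product op M N) w
  accepted-product op M N w = ≡⇒⇔ (cong (So ∘ final (product op M N)) (sym (run-product op M N w)))

  rec-× : ∀ {P Q} → Recognisable W P → Recognisable W Q → Recognisable W (λ k e → P k e × Q k e)
  rec-× R S = record
    { automaton = product _∧_ (automaton R) (automaton S)
    ; correct = λ e → accepted-product _∧_ (automaton R) (automaton S) (word W e)
        ⇔-∘ (⇔-sym T-∧ ⇔-∘ (correct R e ×-⇔ correct S e)) }

  rec-⊎ : ∀ {P Q} → Recognisable W P → Recognisable W Q → Recognisable W (λ k e → P k e ⊎ Q k e)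
  rec-⊎ R S = record
    { automaton = product _∨_ (automaton R) (automaton S)
    ; correct = λ e → accepted-product _∨_ (automaton R) (automaton S) (word W e)
        ⇔-∘ (⇔-sym T-∨ ⇔-∘ (correct R e ⊎-⇔ correct S e)) }

  module _ (p : Letter W → Bool) (p-resp : ∀ {a b} → _≈_ W a b → p a ≡ p b) where

    rec-any : Recognisable W (λ k e → Σ (Fin (suc k)) λ j → So (p (word W e j)))
    rec-any = record
      { automaton = record
          { State = Bool ; finite = finite-Bool ; start = false ; step = λ a b → p a ∨ b
          ; step-resp = λ b e → cong (_∨ b) (p-resp e) ; final = id }
      ; correct = λ e → mk⇔ (λ (j , x) → sound (word W e) j x) (complete (word W e)) }
      where
      sound : ∀ {n} (w : Fin n → Letter W) j → So (p (w j)) → So (foldWord (λ a b → p a ∨ b) false w)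
      sound w zero    x = from T-∨ (inj₁ x)
      sound w (suc j) x = from (T-∨ {x = p (w zero)}) (inj₂ (sound (w ∘ suc) j x))
      complete : ∀ {n} (w : Fin n → Letter W) → So (foldWord (λ a b → p a ∨ b) false w) →
                 Σ (Fin n) λ j → So (p (w j))
      complete {suc n} w x with to (T-∨ {x = p (w zero)}) x
      ... | inj₁ y = zero , y
      ... | inj₂ y with complete (w ∘ suc) y
      ...   | j , z = suc j , z

    rec-first : Recognisable W (λ k e → So (p (word W e zero)))
    rec-first = record
      { automaton = record
          { State = Bool ; finite = finite-Bool ; start = false ; step = λ a _ → p a
          ; step-resp = λ _ → p-resp ; final = id }
      ; correct = λ e → mk⇔ id id }

    -- Reading goes from right to left, so the last letter is met first and has to be remembered; in
    -- `rec-first` each new letter simply overwrites the state.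
    rec-last : Recognisable W (λ k e → So (p (word W e (fromℕ k))))
    rec-last = record
      { automaton = record
          { State = Maybe Bool ; finite = finite-Maybe finite-Bool ; start = nothing ; step = next
          ; step-resp = λ { nothing e → cong just (p-resp e) ; (just _) _ → refl }
          ; final = maybe id false }
      ; correct = λ {k} e → ≡⇒⇔ (cong (So ∘ maybe id false) (sym (run-last (word W e)))) }
      where
      next : Letter W → Maybe Bool → Maybe Bool
      next a nothing  = just (p a)
      next a (just b) = just b
      run-last : ∀ {n} (w : Fin (suc n) → Letter W) → foldWord next nothing w ≡ just (p (w (fromℕ n)))
      run-last {zero}  w = refl
      run-last {suc n} w rewrite run-last (w ∘ suc) = refl

    rec-all : Recognisable W (λ k e → ∀ j → So (p (word W e j)))
    rec-all = record
      { automaton = record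
          { State = Bool ; finite = finite-Bool ; start = true ; step = λ a b → p a ∧ b
          ; step-resp = λ b e → cong (_∧ b) (p-resp e) ; final = id }
      ; correct = λ e → correct-all (word W e) }
      where
      correct-all : ∀ {n} (w : Fin n → Letter W) →
                    (∀ j → So (p (w j))) ⇔ So (foldWord (λ a b → p a ∧ b) true w)
      correct-all {zero}  w = mk⇔ (λ _ → tt) (λ _ ())
      correct-all {suc n} w = mk⇔
        (λ f → from T-∧ (f zero , to (correct-all (w ∘ suc)) (f ∘ suc)))
        (λ x → λ { zero → proj₁ (to T-∧ x)
                 ; (suc j) → from (correct-all (w ∘ suc)) (proj₂ (to (T-∧ {x = p (w zero)}) x)) j })

    module _ (q : Letter W → Bool) (q-resp : ∀ {a b} → _≈_ W a b → q a ≡ q b) where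

      rec-pair : Recognisable W (λ k e → Σ (Fin (suc k)) λ i → Σ (Fin (suc k)) λ j →
                   i <ᶠ j × So (p (word W e i)) × So (q (word W e j)))
      rec-pair = record
        { automaton = record
            { State = Bool × Bool ; finite = finite-× finite-Bool finite-Bool ; start = false , false
            ; step = next
            ; step-resp = λ (s , b) e → cong₂ _,_ (cong (_∨ s) (q-resp e))
                                                  (cong (λ x → (x ∧ s) ∨ b) (p-resp e))
            ; final = proj₂ }
        ; correct = λ e → mk⇔ (λ (i , j , l , x , y) → sound (word W e) i j l x y)
                              (complete (word W e)) }
        where
        next : Letter W → Bool × Bool → Bool × Bool
        -- `s` says that a `q`-letter has been read, `b` that a pair has been found. Testing `p a`
        -- against the old `s` makes the order strict.
        next a (s , b) = q a ∨ s , (p a ∧ s) ∨ b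
        fold = foldWord next (false , false)
        seen : ∀ {n} (w : Fin n → Letter W) j → So (q (w j)) → So (proj₁ (fold w))
        seen w zero    x = from T-∨ (inj₁ x)
        seen w (suc j) x = from (T-∨ {x = q (w zero)}) (inj₂ (seen (w ∘ suc) j x))
        seen⁻ : ∀ {n} (w : Fin n → Letter W) → So (proj₁ (fold w)) → Σ (Fin n) λ j → So (q (w j))
        seen⁻ {suc n} w x with to (T-∨ {x = q (w zero)}) x
        ... | inj₁ y = zero , y
        ... | inj₂ y with seen⁻ (w ∘ suc) y
        ...   | j , z = suc j , z
        sound : ∀ {n} (w : Fin n → Letter W) i j → i <ᶠ j → So (p (w i)) → So (q (w j)) →
                So (proj₂ (fold w))
        sound w zero    (suc j) l x y = from T-∨ (inj₁ (from T-∧ (x , seen (w ∘ suc) j y)))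
        sound w (suc i) (suc j) l x y =
          from (T-∨ {x = p (w zero) ∧ _}) (inj₂ (sound (w ∘ suc) i j (s≤s⁻¹ l) x y))
        complete : ∀ {n} (w : Fin n → Letter W) → So (proj₂ (fold w)) →
                   Σ (Fin n) λ i → Σ (Fin n) λ j → i <ᶠ j × So (p (w i)) × So (q (w j))
        complete {suc n} w x with to (T-∨ {x = p (w zero) ∧ _}) x
        ... | inj₁ y with to (T-∧ {x = p (w zero)}) y
        ...   | u , v with seen⁻ (w ∘ suc) v
        ...     | j , z = zero , suc j , s≤s z≤n , u , z
        complete {suc n} w x | inj₂ y with complete (w ∘ suc) y
        ... | i , j , l , u , v = suc i , suc j , s≤s l , u , v

  module _ {C : Set} (fin : Finite C) (code : Letter W → C)
           (code-resp : ∀ {a b} → _≈_ W a b → code a ≡ code b) (R : C → C → Bool) where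

    -- The right neighbour must be kept in the state, which is why the relation acts on codes from a
    -- finite `C` and not on letters.
    rec-consecutive : Recognisable W (λ k e → ∀ (j : Fin k) →
                        So (R (code (word W e (inject₁ j))) (code (word W e (suc j)))))
    rec-consecutive = record
      { automaton = record
          { State = Maybe (C × Bool) ; finite = finite-Maybe (finite-× fin finite-Bool)
          ; start = nothing ; step = next
          ; step-resp = λ { nothing e → cong (λ c → just (c , true)) (code-resp e)
                          ; (just (d , b)) e → cong (λ c → just (c , R c d ∧ b)) (code-resp e) }
          ; final = maybe proj₂ false }
      ; correct = λ e → correct-all (word W e) }
      where
      next : Letter W → Maybe (C × Bool) → Maybe (C × Bool)
      next a nothing        = just (code a , true)
      next a (just (d , b)) = just (code a , R (code a) d ∧ b)
      fold = foldWord next nothing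
      run-code : ∀ {n} (w : Fin (suc n) → Letter W) → fold w ≡ just (code (w zero) , maybe proj₂ false (fold w))
      run-code {zero}  w = refl
      run-code {suc n} w rewrite run-code (w ∘ suc) = refl
      correct-all : ∀ {n} (w : Fin (suc n) → Letter W) →
        (∀ (j : Fin n) → So (R (code (w (inject₁ j))) (code (w (suc j))))) ⇔ So (maybe proj₂ false (fold w))
      correct-all {zero}  w = mk⇔ (λ _ → tt) (λ _ ())
      correct-all {suc n} w rewrite run-code (w ∘ suc) = mk⇔
        (λ f → from T-∧ (f zero , to (correct-all (w ∘ suc)) (f ∘ suc)))
        (λ x → λ { zero → proj₁ (to T-∧ x)
                 ; (suc j) → from (correct-all (w ∘ suc)) (proj₂ (to (T-∧ {x = R (code (w zero)) _}) x)) j })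

  rec-⊤ : ∀ {P} → (∀ k e → P k e) → Recognisable W P
  rec-⊤ p = rec-⇔ (rec-all (λ _ → true) (λ _ → refl)) (λ k e → mk⇔ (λ _ → p k e) (λ _ _ → tt))

  rec-∀Fin : ∀ a {P : Fin a → ∀ k → Env W k → Set} → (∀ i → Recognisable W (P i)) →
             Recognisable W (λ k e → ∀ i → P i k e)
  rec-∀Fin zero    R = rec-⊤ (λ _ _ ())
  rec-∀Fin (suc a) R = rec-⇔ (rec-× (R zero) (rec-∀Fin a (R ∘ suc)))
    (λ k e → mk⇔ (λ (x , f) → λ { zero → x ; (suc i) → f i }) (λ f → f zero , f ∘ suc))

-- Recognisable languages are closed under inverse images of letter-to-letter maps. This is the tool
-- for forgetting, rearranging and combining tracks: it applies whenever the word of `f e` can be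
-- computed one position at a time, up to the equivalence.
pullback : ∀ {V W P} (f : ∀ {k} → Env V k → Env W k) (g : Letter V → Letter W) →
  (∀ {a b} → _≈_ V a b → _≈_ W (g a) (g b)) →
  (∀ {k} (e : Env V k) j → _≈_ W (word W (f e) j) (g (word V e j))) →
  Recognisable W P → Recognisable V (λ k e → P k (f e))
pullback {V} {W} f g g-resp fg R = record
  { automaton = record
      { State = State M ; finite = finite M ; start = start M ; step = step M ∘ g
      ; step-resp = λ q e → step-resp M q (g-resp e) ; final = final M }
  ; correct = λ e → ≡⇒⇔ (cong (So ∘ final M) (trans (run-cong M (fg e)) (run-g (word V e)))) ⇔-∘ correct R (f e) }
  where
  M = automaton R
  run-g : ∀ {n} (w : Fin n → Letter V) → run M (g ∘ w) ≡ foldWord (step M ∘ g) (start M) w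
  run-g {zero}  w = refl
  run-g {suc n} w = cong (step M (g (w zero))) (run-g (w ∘ suc))

-- Quantification over tracks

-- The value stays in the environment while the automaton sees only its track. The type of values
-- may depend on the environment, as the domain of a derived structure does.
withTrack : (W : Coding) (V : ∀ {k} → Env W k → Set) {C : Set} →
            (∀ {k} (e : Env W k) → V e → Fin (suc k) → C) → Coding
withTrack W V {C} track = record
  { Env = λ k → Σ (Env W k) V
  ; Letter = C × Letter W
  ; _≈_ = λ (c , a) (d , b) → c ≡ d × _≈_ W a b
  ; word = λ (e , v) j → track e v j , word W e j }

withFreeTrack : Coding → Set → Coding
withFreeTrack W C = withTrack W (λ {k} _ → Fin (suc k) → C) (λ _ z → z)

module _ {W : Coding} {C : Set} (fin : Finite C) where

  -- The subset construction.
  rec-project : ∀ {P} → Recognisable (withFreeTrack W C) P →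
                Recognisable W (λ k e → Σ (Fin (suc k) → C) λ z → P k (e , z))
  rec-project R = record
    { automaton = record
        { State = Vec Bool (size (finite M)) ; finite = finite-Vec finite-Bool _
        ; start = start′ ; step = step′
        ; step-resp = λ S e → tabulate-cong λ q → ⌊⌋-cong (mk⇔
            (λ (c , p , m , x) → c , p , m , trans (sym (step-resp M p (refl , e))) x)
            (λ (c , p , m , x) → c , p , m , trans (step-resp M p (refl , e)) x)) (succ? _ S q) (succ? _ S q)
        ; final = λ S → ⌊ final? S ⌋ }
    ; correct = λ e → mk⇔
        (λ (z , x) → from (So-⌊⌋ (final? (states (word W e))))
          (_ , from (reached (word W e) _) (z , refl) , to (correct R (e , z)) x))
        (λ x → let (q , m , f) = to (So-⌊⌋ (final? (states (word W e)))) x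
                   (z , y) = to (reached (word W e) q) m
               in z , from (correct R (e , z)) (subst (So ∘ final M) (sym y) f)) }
    where
    M = automaton R
    St = Vec Bool (size (finite M))
    _∋_ : St → State M → Set
    S ∋ q = So (lookup S (index (finite M) q))
    succ? : ∀ a (S : St) i → Dec (Σ C λ c → Σ (State M) λ p → S ∋ p × step M (c , a) p ≡ elem (finite M) i)
    succ? a S i = exists? fin λ c → exists? (finite M) λ p → T? _ ×-dec (_≟_ (finite M) _ _)
    final? : ∀ (S : St) → Dec (Σ (State M) λ q → S ∋ q × So (final M q))
    final? S = exists? (finite M) λ q → T? _ ×-dec T? _
    start′ : St
    start′ = tabulate λ i → ⌊ _≟_ (finite M) (start M) (elem (finite M) i) ⌋
    step′ : Letter W → St → St
    step′ a S = tabulate λ i → ⌊ succ? a S i ⌋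
    states : ∀ {n} → (Fin n → Letter W) → St
    states = foldWord step′ start′
    in-tabulate : ∀ (f : Fin (size (finite M)) → Bool) q → So (f (index (finite M) q)) ⇔ (tabulate f ∋ q)
    in-tabulate f q = ≡⇒⇔ (cong So (sym (lookup∘tabulate f _)))
    reached : ∀ {n} (w : Fin n → Letter W) q →
      (states w ∋ q) ⇔ Σ (Fin n → C) λ z → run M (λ j → z j , w j) ≡ q
    reached {zero} w q =
      mk⇔ (λ x → (λ ()) , trans x (elem-index (finite M) q)) (λ (_ , x) → trans x (sym (elem-index (finite M) q)))
      ⇔-∘ (So-⌊⌋ (_≟_ (finite M) _ _) ⇔-∘ ⇔-sym (in-tabulate _ q))
    reached {suc n} w q =
      mk⇔ (λ (c , p , m , x) → let (z , y) = to (reached (w ∘ suc) p) m in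
             extend c z , trans (cong (step M (c , w zero)) y) (trans x (elem-index (finite M) q)))
          (λ (z , x) → z zero , _ , from (reached (w ∘ suc) _) (z ∘ suc , refl) ,
             trans x (sym (elem-index (finite M) q)))
      ⇔-∘ (So-⌊⌋ (succ? (w zero) (states (w ∘ suc)) _) ⇔-∘ ⇔-sym (in-tabulate _ q))

  module _ {V : ∀ {k} → Env W k → Set} (track : ∀ {k} (e : Env W k) → V e → Fin (suc k) → C)
           (image : Recognisable (withFreeTrack W C) (λ k (e , z) → Σ (V e) λ v → ∀ j → track e v j ≡ z j)) where

    -- Projection guesses an arbitrary track, and `image` discards those that encode nothing.
    -- Several values may share a track, for instance a string with different acceptance proofs, but
    -- the automaton for `P` cannot tell them apart, so whichever value `image` returns is a
    -- witness.
    rec-∃ : ∀ {P} → Recognisable (withTrack W V track) P → Recognisable W (λ k e → Σ (V e) λ v → P k (e , v))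
    rec-∃ {P} R = rec-⇔ (rec-project (rec-× image accepted)) (λ k e → mk⇔
        (λ (z , (v , same-track) , x) →
          v , from (correct R (e , v)) (subst (So ∘ final M) (sym (same e v z same-track)) x))
        (λ (v , x) → track e v , (v , λ _ → refl) , to (correct R (e , v)) x))
      where
      M = automaton R
      Z = withFreeTrack W C
      accepted : Recognisable Z (λ k e → Accepted M (word Z e))
      accepted = record { automaton = M ; correct = λ e → mk⇔ id id }
      same : ∀ {k} (e : Env W k) v z → (∀ j → track e v j ≡ z j) →
             run M (λ j → track e v j , word W e j) ≡ run M (λ j → z j , word W e j)
      same e v z = run-cong′ (word W e) (track e v) z
        where
        run-cong′ : ∀ {n} (w : Fin n → Letter W) (y z : Fin n → C) → (∀ j → y j ≡ z j) →
                    run M (λ j → y j , w j) ≡ run M (λ j → z j , w j)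
        run-cong′ {zero}  w y z same-track = refl
        run-cong′ {suc n} w y z same-track rewrite same-track zero =
          cong (step M (z zero , w zero)) (run-cong′ (w ∘ suc) (y ∘ suc) (z ∘ suc) (same-track ∘ suc))

    -- The dual of `rec-∃`. Passing from the absence of a counterexample back to `P` is constructive
    -- because the automaton decides `P`.
    rec-∀ : ∀ {P} → Recognisable (withTrack W V track) P → Recognisable W (λ k e → ∀ (v : V e) → P k (e , v))
    rec-∀ R = rec-⇔ (rec-¬ (rec-∃ (rec-¬ R))) (λ k e → mk⇔
        (λ none v → decidable-stable (dec R (e , v)) (λ ¬p → none (v , ¬p)))
        (λ f (v , ¬p) → ¬p (f v)))

-- Emptiness

-- Existential search up to _≈_: all that is needed of a finite set of letters
-- that are compared extensionally.
Searchable : (A : Set) → (A → A → Set) → Set₁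
Searchable A _≈_ = ∀ {P : A → Set} → (∀ {a b} → a ≈ b → P a → P b) → (∀ a → Dec (P a)) → Dec (Σ A P)

vecCoding : (A : Set) → (A → A → Set) → Coding
vecCoding A _≈_ = record { Env = λ k → Vec A (suc k) ; Letter = A ; _≈_ = _≈_ ; word = lookup }

module _ {A : Set} {_≈_ : A → A → Set} (≈-sym : ∀ {a b} → a ≈ b → b ≈ a) (search : Searchable A _≈_) where

  module _ (M : Automaton _≈_) where

    _⟶_ : State M → State M → Set
    p ⟶ q = Σ A λ a → step M a p ≡ q

    _⟶?_ : ∀ p q → Dec (p ⟶ q)
    p ⟶? q = search (λ a≈b → trans (step-resp M p (≈-sym a≈b))) (λ a → _≟_ (finite M) (step M a p) q)

    -- Runs are right folds, so each further edge prepends a letter; `x` accumulates the suffix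
    -- already read. Conversely, in `word⇒path` the head letter is the last edge.
    path⇒word : ∀ {p q n} (x : Vec A n) → run M (lookup x) ≡ p → TransClosure _⟶_ p q →
                Σ ℕ λ k → Σ (Vec A (suc k)) λ y → run M (lookup y) ≡ q
    path⇒word x refl [ a , e ]       = _ , a ∷ x , e
    path⇒word x refl ((a , e) ∷ path) = path⇒word (a ∷ x) e path

    word⇒path : ∀ {k} (x : Vec A (suc k)) → TransClosure _⟶_ (start M) (run M (lookup x))
    word⇒path (a ∷ [])    = [ a , refl ]
    word⇒path (a ∷ b ∷ x) = word⇒path (b ∷ x) ∷ʳ (a , refl)

  -- The closure is transitive but not reflexive: a word must have at least one letter, so an
  -- accepting start state alone is no witness.
  nonempty? : ∀ {P} → Recognisable (vecCoding A _≈_) P → Dec (Σ ℕ λ k → Σ (Vec A (suc k)) (P k))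
  nonempty? {P} R = map′
    (λ (q , path , f) → let (k , x , e) = path⇒word M [] refl path
                        in k , x , from (correct R x) (subst (So ∘ final M) (sym e) f))
    (λ (k , x , p) → run M (lookup x) , word⇒path M x , to (correct R x) p)
    (exists? (finite M) λ q → transClosure? (finite M) (_⟶_ M) (_⟶?_ M) (start M) q ×-dec T? (final M q))
    where M = automaton R

search-× : ∀ {A B _≈_ _≋_} → (∀ {a} → a ≈ a) → (∀ {b} → b ≋ b) → Searchable A _≈_ → Searchable B _≋_ →
           Searchable (A × B) (λ x y → (proj₁ x ≈ proj₁ y) × (proj₂ x ≋ proj₂ y))
search-× ≈-refl ≋-refl A B resp P? =
  map′ (λ (a , b , p) → (a , b) , p) (λ ((a , b) , p) → a , b , p)
    (A (λ e (b , p) → b , resp (e , ≋-refl) p) (λ a → B (λ e → resp (≈-refl , e)) (λ b → P? (a , b))))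

nilΠ : {A : Fin 0 → Set} → ∀ i → A i
nilΠ ()

consΠ : ∀ {m} {A : Fin (suc m) → Set} → A zero → (∀ i → A (suc i)) → ∀ i → A i
consΠ a f zero    = a
consΠ a f (suc i) = f i

-- A function and its reassembly by `consΠ` agree only pointwise, so invariance of `P` is what
-- carries a given witness to the one that the search visits.
search-Π : ∀ m {A : Fin m → Set} {_≈_ : ∀ {i} → A i → A i → Set} → (∀ {i} {a : A i} → a ≈ a) →
           (∀ i → Searchable (A i) _≈_) → Searchable (∀ i → A i) (λ f g → ∀ i → f i ≈ g i)
search-Π zero    ≈-refl A resp P? = map′ (λ p → nilΠ , p) (λ (f , p) → resp {b = nilΠ} (λ ()) p) (P? nilΠ)
search-Π (suc m) ≈-refl A resp P? =
  map′ (λ (a , f , p) → consΠ a f , p)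
       (λ (f , p) → f zero , f ∘ suc , resp (λ { zero → ≈-refl ; (suc i) → ≈-refl }) p)
    (A zero (λ e (f , p) → f , resp (λ { zero → e ; (suc i) → ≈-refl }) p)
      (λ a → search-Π m ≈-refl (A ∘ suc) (λ e → resp (λ { zero → ≈-refl ; (suc i) → e i }))
        (λ f → P? (consΠ a f))))

-- Monadic second-order logic

module _ {Γ : Set} {_≈Γ_ : Γ → Γ → Set} (≈Γ-isDec : IsDecEquivalence _≈Γ_) where

  private module ≈Γ = IsDecEquivalence ≈Γ-isDec

  msoCoding : ℕ → ℕ → Coding
  msoCoding n m = record
    { Env = λ k → Vec Γ (suc k) × (Fin n → Fin (suc k)) × (Fin m → Subset (suc k))
    ; Letter = Γ × (Fin n → Bool) × (Fin m → Bool)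
    ; _≈_ = λ (a , s , t) (a′ , s′ , t′) → a ≈Γ a′ × s ≗ s′ × t ≗ t′
    ; word = λ (x , ρ , σ) j → lookup x j , (λ i → ⌊ ρ i ≟ᶠ j ⌋) , (λ X → lookup (σ X) j) }

  module _ {n m : ℕ} where

    private W = msoCoding n m

    -- The position `ρ i` is the only one carrying the mark of variable `i`, so speaking about its
    -- letter amounts to an existential over marked positions.
    rec-at-position : (i : Fin n) (p : Letter W → Bool) → (∀ {a b} → _≈_ W a b → p a ≡ p b) →
                      Recognisable W (λ k e → So (p (word W e (proj₁ (proj₂ e) i))))
    rec-at-position i p p-resp = rec-⇔
      (rec-any (λ a → proj₁ (proj₂ a) i ∧ p a) (λ e → cong₂ _∧_ (proj₁ (proj₂ e) i) (p-resp e)))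
      (λ k e → mk⇔
        (λ (j , x) → let (y , z) = to T-∧ x in subst (λ j → So (p (word W e j))) (sym (to (So-⌊⌋ (_ ≟ᶠ j)) y)) z)
        (λ x → _ , from T-∧ (from (So-⌊⌋ (_ ≟ᶠ _)) refl , x)))

    -- A track encodes a position when it has some mark and no two marks in increasing order;
    -- trichotomy turns the second condition into uniqueness.
    image-position : Recognisable (withFreeTrack W Bool)
      (λ k (e , z) → Σ (Fin (suc k)) λ p → ∀ j → ⌊ p ≟ᶠ j ⌋ ≡ z j)
    image-position = rec-⇔
      (rec-× (rec-any proj₁ proj₁) (rec-¬ (rec-pair proj₁ proj₁ proj₁ proj₁)))
      (λ k (e , z) → mk⇔
        (λ ((p , x) , unique) → p , λ j → singleton z p x unique j)
        (λ (p , same) →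
          (p , subst So (same p) (from (So-⌊⌋ (p ≟ᶠ p)) refl)) ,
          λ (i , j , i<j , x , y) → absurd i j i<j
            (to (So-⌊⌋ (p ≟ᶠ i)) (subst So (sym (same i)) x))
            (to (So-⌊⌋ (p ≟ᶠ j)) (subst So (sym (same j)) y))))
      where
      absurd : ∀ {k} {p : Fin (suc k)} i j → i <ᶠ j → p ≡ i → p ≡ j → ⊥
      absurd i j i<j refl refl = <-irrefl {x = i} refl i<j
      singleton : ∀ {k} (z : Fin k → Bool) p → So (z p) →
                  ¬ (Σ (Fin k) λ i → Σ (Fin k) λ j → i <ᶠ j × So (z i) × So (z j)) →
                  ∀ j → ⌊ p ≟ᶠ j ⌋ ≡ z j
      singleton z p x unique j with p ≟ᶠ j | z j in zj
      ... | yes refl | true  = refl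
      ... | yes refl | false with () ← subst So zj x
      ... | no p≢j | false = refl
      ... | no p≢j | true with <-cmp p j
      ...   | tri< l _ _ = contradiction (p , j , l , x , subst So (sym zj) _) unique
      ...   | tri≈ _ e _ = contradiction e p≢j
      ...   | tri> _ _ l = contradiction (j , p , l , subst So (sym zj) _ , x) unique

    image-set : Recognisable (withFreeTrack W Bool)
      (λ k (e , z) → Σ (Subset (suc k)) λ S → ∀ j → lookup S j ≡ z j)
    image-set = rec-⊤ (λ k (e , z) → tabulate z , lookup∘tabulate z)

    bind-position : ∀ {P} → Recognisable (msoCoding (suc n) m) P →
      Recognisable (withTrack W (λ {k} _ → Fin (suc k)) (λ _ p j → ⌊ p ≟ᶠ j ⌋))
                   (λ k ((x , ρ , σ) , p) → P k (x , extend p ρ , σ))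
    bind-position = pullback
      (λ ((x , ρ , σ) , p) → x , extend p ρ , σ)
      (λ (b , a , s , t) → a , extend b s , t)
      (λ (e , a , s , t) → a , (λ { zero → e ; (suc i) → s i }) , t)
      (λ e j → ≈Γ.refl , (λ { zero → refl ; (suc i) → refl }) , λ _ → refl)

    bind-set : ∀ {P} → Recognisable (msoCoding n (suc m)) P →
      Recognisable (withTrack W (λ {k} _ → Subset (suc k)) (λ _ → lookup))
                   (λ k ((x , ρ , σ) , S) → P k (x , ρ , extend S σ))
    bind-set = pullback
      (λ ((x , ρ , σ) , S) → x , ρ , extend S σ)
      (λ (b , a , s , t) → a , s , extend b t)
      (λ (e , a , s , t) → a , s , (λ { zero → e ; (suc i) → t i }))
      (λ e j → ≈Γ.refl , (λ _ → refl) , λ { zero → refl ; (suc i) → refl })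

  rec-MSO : ∀ {n m} (f : MSO Γ n m) →
            Recognisable (msoCoding n m) (λ k (x , ρ , σ) → SatMSO _≈Γ_ x ρ σ f)
  rec-MSO (letter b i) = rec-⇔
    (rec-at-position i (λ (a , _) → ⌊ a ≈Γ.≟ b ⌋)
      (λ {(a , _)} {(a′ , _)} (e , _) → ⌊⌋-cong (mk⇔ (≈Γ.trans (≈Γ.sym e)) (≈Γ.trans e)) (a ≈Γ.≟ b) (a′ ≈Γ.≟ b)))
    (λ k (x , ρ , σ) → So-⌊⌋ (lookup x (ρ i) ≈Γ.≟ b))
  rec-MSO (less i j) = rec-⇔
    (rec-pair (λ (_ , s , _) → s i) (λ (_ , s , _) → s i) (λ (_ , s , _) → s j) (λ (_ , s , _) → s j))
    (λ k (x , ρ , σ) → mk⇔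
      (λ (p , q , l , y , z) → ordered l (to (So-⌊⌋ (ρ i ≟ᶠ p)) y) (to (So-⌊⌋ (ρ j ≟ᶠ q)) z))
      (λ l → ρ i , ρ j , l , from (So-⌊⌋ (ρ i ≟ᶠ ρ i)) refl , from (So-⌊⌋ (ρ j ≟ᶠ ρ j)) refl))
    where
    ordered : ∀ {k} {p q p′ q′ : Fin k} → p <ᶠ q → p′ ≡ p → q′ ≡ q → p′ <ᶠ q′
    ordered l refl refl = l
  rec-MSO (equal i j) = rec-⇔
    (rec-at-position i (λ (_ , s , _) → s j) (λ (_ , s , _) → s j))
    (λ k (x , ρ , σ) → mk⇔ sym sym ⇔-∘ So-⌊⌋ (ρ j ≟ᶠ ρ i))
  rec-MSO (mem i X) = rec-⇔
    (rec-at-position i (λ (_ , _ , t) → t X) (λ (_ , _ , t) → t X))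
    (λ k (x , ρ , σ) → mk⇔
      (λ s → lookup⇒[]= (ρ i) (σ X) (to T-≡ s)) (λ e → from T-≡ ([]=⇒lookup e)))
  rec-MSO (neg f)   = rec-¬ (rec-MSO f)
  rec-MSO (and f g) = rec-× (rec-MSO f) (rec-MSO g)
  rec-MSO (or f g)  = rec-⊎ (rec-MSO f) (rec-MSO g)
  rec-MSO (ex₁ f)   = rec-∃ finite-Bool _ image-position (bind-position (rec-MSO f))
  rec-MSO (all₁ f)  = rec-∀ finite-Bool _ image-position (bind-position (rec-MSO f))
  rec-MSO (ex₂ f)   = rec-∃ finite-Bool _ image-set (bind-set (rec-MSO f))
  rec-MSO (all₂ f)  = rec-∀ finite-Bool _ image-set (bind-set (rec-MSO f))

  -- The empty assignments are parameters because two maps out of `Fin 0` need not be definitionally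
  -- equal; the result then applies to the very maps used in `Models-MSO`.
  rec-MSO-sentence : (f : MSO Γ 0 0) (ρ : ∀ {k} → Vec Γ (suc k) → Fin 0 → Fin (suc k))
    (σ : ∀ {k} → Vec Γ (suc k) → Fin 0 → Subset (suc k)) →
    Recognisable (vecCoding Γ _≈Γ_) (λ k x → SatMSO _≈Γ_ x (ρ x) (σ x) f)
  rec-MSO-sentence f ρ σ = pullback (λ x → x , ρ x , σ x) (λ a → a , (λ ()) , (λ ()))
    (λ e → e , (λ ()) , (λ ())) (λ e j → ≈Γ.refl , (λ ()) , (λ ())) (rec-MSO f)

-- Layers

finite-Subset : ∀ n → Finite (Subset n)
finite-Subset = finite-Vec finite-Bool

module _ {A : Set} {w : ℕ} where

  ≈L-refl : {B : Layer A w} → B ≈L B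
  ≈L-refl = refl , refl , (λ _ _ _ → refl) , refl , refl , refl , refl

  ≈L-reflexive : {B C : Layer A w} → B ≡ C → B ≈L C
  ≈L-reflexive {B} refl = ≈L-refl {B}

  ≈L-sym : {B C : Layer A w} → B ≈L C → C ≈L B
  ≈L-sym (a , b , c , d , e , f , g) = sym a , sym b , (λ p x q → sym (c p x q)) , sym d , sym e , sym f , sym g

  ≈L-trans : {B C D : Layer A w} → B ≈L C → C ≈L D → B ≈L D
  ≈L-trans (a , b , c , d , e , f , g) (a′ , b′ , c′ , d′ , e′ , f′ , g′) =
    trans a a′ , trans b b′ , (λ p x q → trans (c p x q) (c′ p x q)) ,
    trans d d′ , trans e e′ , trans f f′ , trans g g′

  module _ (fin : Finite A) where

    _≈L?_ : (B C : Layer A w) → Dec (B ≈L C)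
    B ≈L? C = (ℓ B ≟ˢ ℓ C) ×-dec (r B ≟ˢ r C) ×-dec
      all? (λ p → forall? (finite-Maybe fin) λ c → all? λ q → T B p c q ≟ᵇ T C p c q) ×-dec
      (I B ≟ˢ I C) ×-dec (F B ≟ˢ F C) ×-dec (ι B ≟ᵇ ι C) ×-dec (φ B ≟ᵇ φ C)
      where _≟ˢ_ = _≟_ (finite-Subset w)

    private
      edges : Finite (Fin w × Maybe A × Fin w)
      edges = finite-× (finite-Fin w) (finite-× (finite-Maybe fin) (finite-Fin w))

      -- Without proof fields, and with the transitions tabulated as bits, the data form a finite
      -- type, from which every layer is recovered up to `_≈L_`.
      Raw : Set
      Raw = Subset w × Subset w × Vec Bool (size edges) × Subset w × Subset w × Bool × Bool

      finite-Raw : Finite Raw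
      finite-Raw = finite-× S (finite-× S (finite-× (finite-Vec finite-Bool _)
                     (finite-× S (finite-× S (finite-× finite-Bool finite-Bool)))))
        where S = finite-Subset w

      edge : Raw → Fin w → Maybe A → Fin w → Bool
      edge (_ , _ , t , _) p c q = lookup t (index edges (p , c , q))

      Valid : Raw → Set
      Valid x@(l , s , _ , i , f , a , b) =
        (∀ p c q → edge x p c q ≡ true → p ∈ l × q ∈ s) ×
        i ⊆ l × f ⊆ s × (a ≡ false → i ≡ ∅) × (b ≡ false → f ≡ ∅)

      valid? : ∀ x → Dec (Valid x)
      valid? x@(l , s , _ , i , f , a , b) =
        all? (λ p → forall? (finite-Maybe fin) λ c → all? λ q →
          (edge x p c q ≟ᵇ true) →-dec ((p ∈? l) ×-dec (q ∈? s))) ×-dec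
        (i ⊆? l) ×-dec (f ⊆? s) ×-dec
        ((a ≟ᵇ false) →-dec _≟_ (finite-Subset w) i ∅) ×-dec
        ((b ≟ᵇ false) →-dec _≟_ (finite-Subset w) f ∅)

      toLayer : ∀ x → Valid x → Layer A w
      toLayer x@(l , s , _ , i , f , a , b) (t , u , v , y , z) = record
        { ℓ = l ; r = s ; T = edge x ; I = i ; F = f ; ι = a ; φ = b
        ; T⊆ = t ; I⊆ = u ; F⊆ = v ; ιI = y ; φF = z }

      fromLayer : Layer A w → Raw
      fromLayer B = ℓ B , r B , tabulate (λ i → let (p , c , q) = elem edges i in T B p c q) ,
                    I B , F B , ι B , φ B

      edge-fromLayer : ∀ B p c q → edge (fromLayer B) p c q ≡ T B p c q
      edge-fromLayer B p c q = trans (lookup∘tabulate _ (index edges (p , c , q)))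
        (cong (λ (p , c , q) → T B p c q) (elem-index edges (p , c , q)))

      valid-fromLayer : ∀ B → Valid (fromLayer B)
      valid-fromLayer B = (λ p c q e → T⊆ B p c q (trans (sym (edge-fromLayer B p c q)) e)) ,
                          I⊆ B , F⊆ B , ιI B , φF B

    search-Layer : Searchable (Layer A w) _≈L_
    search-Layer {P} resp P? = map′
      (λ (x , v , p) → toLayer x v , p)
      (λ (B , p) → fromLayer B , valid-fromLayer B ,
        resp (refl , refl , (λ p c q → sym (edge-fromLayer B p c q)) , refl , refl , refl , refl) p)
      (exists? finite-Raw valid-and?)
      where
      valid-and? : ∀ x → Dec (Σ (Valid x) λ v → P (toLayer x v))
      valid-and? x with valid? x
      ... | no ¬v = no (¬v ∘ proj₁)
      -- Another validity proof gives a layer with the same data, hence equivalent, so testing `P`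
      -- at one proof settles all of them.
      ... | yes v = map′ (v ,_)
        (λ (_ , p) → resp (refl , refl , (λ _ _ _ → refl) , refl , refl , refl , refl) p) (P? (toLayer x v))

-- Padded strings

at-beyond : {A : Set} (u : List A) {n : ℕ} → length u ≤ n → at u n ≡ nothing
at-beyond []      _       = refl
at-beyond (_ ∷ u) (s≤s l) = at-beyond u l

at-nothing : {A : Set} (u : List A) {n : ℕ} → at u n ≡ nothing → length u ≤ n
at-nothing []                _ = z≤n
at-nothing (_ ∷ u) {suc n} e = s≤s (at-nothing u e)

at-ext : {A : Set} (k : ℕ) (u v : List A) → length u ≤ k → length v ≤ k →
         (∀ (j : Fin k) → at u (toℕ j) ≡ at v (toℕ j)) → u ≡ v
at-ext k       []      []      _ _ _ = refl
at-ext (suc k) []      (_ ∷ _) _ _ e with () ← e zero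
at-ext (suc k) (_ ∷ _) []      _ _ e with () ← e zero
at-ext (suc k) (a ∷ u) (b ∷ v) (s≤s l) (s≤s l′) e with refl ← e zero =
  cong (a ∷_) (at-ext k u v l l′ (e ∘ suc))

-- Phrased as the absence of an ordered pair so that `rec-pair` and `rec-¬` recognise it directly.
Padded : {A : Set} {n : ℕ} → (Fin n → Maybe A) → Set
Padded {n = n} z = ¬ (Σ (Fin n) λ i → Σ (Fin n) λ j → i <ᶠ j × So (is-nothing (z i)) × So (is-just (z j)))

padded-at : {A : Set} (u : List A) (n : ℕ) → Padded {n = n} (λ j → at u (toℕ j))
padded-at u n (i , j , i<j , x , y) with at u (toℕ i) in e
... | nothing rewrite at-beyond u (≤-trans (at-nothing u e) (<⇒≤ i<j)) = y

unpad : {A : Set} {n : ℕ} → (Fin n → Maybe A) → List A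
unpad {n = zero}  z = []
unpad {n = suc n} z = maybe (_∷ unpad (z ∘ suc)) [] (z zero)

length-unpad : {A : Set} {n : ℕ} (z : Fin n → Maybe A) → length (unpad z) ≤ n
length-unpad {n = zero}  z = z≤n
length-unpad {n = suc n} z with z zero
... | nothing = z≤n
... | just _  = s≤s (length-unpad (z ∘ suc))

at-unpad : {A : Set} {n : ℕ} (z : Fin n → Maybe A) → Padded z → ∀ j → at (unpad z) (toℕ j) ≡ z j
at-unpad {n = suc n} z pz j with z zero in e
at-unpad {n = suc n} z pz zero    | nothing = sym e
at-unpad {n = suc n} z pz (suc j) | nothing with z (suc j) in e′
... | nothing = refl
... | just _  = contradiction (zero , suc j , s≤s z≤n , subst (So ∘ is-nothing) (sym e) _ ,
                               subst (So ∘ is-just) (sym e′) _) pz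
at-unpad {n = suc n} z pz zero    | just _  = sym e
at-unpad {n = suc n} z pz (suc j) | just _  =
  at-unpad (z ∘ suc) (λ (i , j , l , x , y) → pz (suc i , suc j , s≤s l , x , y)) j

-- Acceptance as a regular property of the padded string

IsRun : {A : Set} {w k : ℕ} → Vec (Layer A w) (suc k) → (Fin (suc k) → Maybe A) →
        (Fin (suc (suc k)) → Fin w) → Set
IsRun {k = k} D z st =
    (∀ j → T (lookup D j) (st (inject₁ j)) (z j) (st (suc j)) ≡ true)
  × (st zero ∈ I (head D)) × (st (fromℕ (suc k)) ∈ F (last D))

-- Nonemptiness becomes a proper symbol at position zero, and the length bound is absorbed by the
-- number of positions.
AcceptsPadded : {A : Set} {w k : ℕ} → Vec (Layer A w) (suc k) → (Fin (suc k) → Maybe A) → Set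
AcceptsPadded D z = So (is-just (z zero)) × Padded z × Σ _ (IsRun D z)

module _ {A : Set} {w k : ℕ} (D : Vec (Layer A w) (suc k)) where

  acceptsPadded-cong : {y z : Fin (suc k) → Maybe A} → (∀ j → y j ≡ z j) → AcceptsPadded D y → AcceptsPadded D z
  acceptsPadded-cong y≡z (x , p , st , t , i , f) =
    subst (So ∘ is-just) (y≡z zero) x ,
    (λ (i , j , l , a , b) → p (i , j , l , subst (So ∘ is-nothing) (sym (y≡z i)) a ,
                                            subst (So ∘ is-just) (sym (y≡z j)) b)) ,
    st , (λ j → subst (λ c → T (lookup D j) (st (inject₁ j)) c (st (suc j)) ≡ true) (y≡z j) (t j)) , i , f

  -- The length hypothesis matters: a longer string would be truncated by its track, which could be
  -- accepted although the string is not.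
  accepts⇔padded : (u : List A) → length u ≤ suc k → Accepts D u ⇔ AcceptsPadded D (λ j → at u (toℕ j))
  accepts⇔padded u l = mk⇔
    (λ (ne , _ , st) → nonempty u ne , padded-at u (suc k) , st)
    (λ (x , _ , st) → (λ { refl → x }) , l , st)
    where
    nonempty : ∀ u → u ≢ [] → So (is-just (at u 0))
    nonempty []      ne = ne refl
    nonempty (_ ∷ _) _  = _

  -- This identifies the tracks of accepted strings, in the form in which `rec-∃` and `rec-∀` ask
  -- for the image; `unpad` provides the string.
  accepted-image : (z : Fin (suc k) → Maybe A) →
    AcceptsPadded D z ⇔ Σ (Σ (List A) (Accepts D)) λ (u , _) → ∀ j → at u (toℕ j) ≡ z j
  accepted-image z = mk⇔
    (λ acc@(_ , p , _) →
      (unpad z , from (accepts⇔padded (unpad z) (length-unpad z))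
                      (acceptsPadded-cong (λ j → sym (at-unpad z p j)) acc)) , at-unpad z p)
    (λ ((u , acc@(_ , l , _)) , e) → acceptsPadded-cong e (to (accepts⇔padded u l) acc))

head≡lookup : {A : Set} {k : ℕ} (x : Vec A (suc k)) → head x ≡ lookup x zero
head≡lookup (_ ∷ _) = refl

last≡lookup : {A : Set} {k : ℕ} (x : Vec A (suc k)) → last x ≡ lookup x (fromℕ k)
last≡lookup (_ ∷ [])    = refl
last≡lookup (_ ∷ b ∷ x) = last≡lookup (b ∷ x)

layerCoding : (A : Set) (w : ℕ) → Coding
layerCoding A w = record
  { Env = λ k → Vec (Layer A w) (suc k) × (Fin (suc k) → Maybe A)
  ; Letter = Layer A w × Maybe A
  ; _≈_ = λ (B , c) (B′ , c′) → (B ≈L B′) × c ≡ c′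
  ; word = λ (D , z) j → lookup D j , z j }

module _ {A : Set} {w : ℕ} where

  private
    V : ∀ {k} → Env (layerCoding A w) k → Set
    V {k} _ = Fin (suc (suc k)) → Fin w

    states : ∀ {k} (e : Env (layerCoding A w) k) → V e → Fin (suc k) → Fin w × Fin w
    states _ st j = st (inject₁ j) , st (suc j)

  -- A run has one state more than there are positions, so each position carries the pair of states
  -- before and after its layer. Such pairs come from a run when neighbours agree on the state they
  -- share.
  image-states : Recognisable (withFreeTrack (layerCoding A w) (Fin w × Fin w))
    (λ k (e , z) → Σ (V e) λ st → ∀ j → states e st j ≡ z j)
  image-states = rec-⇔
    (rec-consecutive (finite-× (finite-Fin w) (finite-Fin w)) proj₁ proj₁ (λ (_ , q) (p , _) → ⌊ q ≟ᶠ p ⌋))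
    (λ k (e , z) → mk⇔
      (λ c → glue z , λ j → cong (_, proj₂ (z j)) (glued z (λ j → to (So-⌊⌋ (_ ≟ᶠ _)) (c j)) j))
      (λ (st , e) j → from (So-⌊⌋ (_ ≟ᶠ _)) (trans (sym (cong proj₂ (e (inject₁ j)))) (cong proj₁ (e (suc j))))))
    where
    glue : ∀ {k} → (Fin (suc k) → Fin w × Fin w) → Fin (suc (suc k)) → Fin w
    glue z zero    = proj₁ (z zero)
    glue z (suc j) = proj₂ (z j)
    glued : ∀ {k} (z : Fin (suc k) → Fin w × Fin w) →
            (∀ (j : Fin k) → proj₂ (z (inject₁ j)) ≡ proj₁ (z (suc j))) →
            ∀ j → glue z (inject₁ j) ≡ proj₁ (z j)
    glued z c zero    = refl
    glued z c (suc j) = c j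

  rec-IsRun : Recognisable (withTrack (layerCoding A w) V states) (λ k ((D , z) , st) → IsRun D z st)
  rec-IsRun = rec-⇔
    (rec-× (rec-all (λ ((p , q) , B , c) → T B p c q) (λ { (refl , (_ , _ , t , _) , refl) → t _ _ _ }))
    (rec-× (rec-first (λ ((p , q) , B , c) → ⌊ p ∈? I B ⌋)
                      (λ { {(p , _) , _} (refl , (_ , _ , _ , i , _) , refl) → cong (λ S → ⌊ p ∈? S ⌋) i }))
           (rec-last (λ ((p , q) , B , c) → ⌊ q ∈? F B ⌋)
                      (λ { {(_ , q) , _} (refl , (_ , _ , _ , _ , f , _) , refl) → cong (λ S → ⌊ q ∈? S ⌋) f }))))
    (λ k ((D , z) , st) →
      mk⇔ (λ t j → to T-≡ (t j)) (λ t j → from T-≡ (t j)) ×-⇔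
      (≡⇒⇔ (cong (λ B → st zero ∈ I B) (sym (head≡lookup D))) ⇔-∘ So-⌊⌋ (_ ∈? _)) ×-⇔
      (≡⇒⇔ (cong (λ B → st (fromℕ (suc k)) ∈ F B) (sym (last≡lookup D))) ⇔-∘ So-⌊⌋ (_ ∈? _)))

  rec-AcceptsPadded : Recognisable (layerCoding A w) (λ k (D , z) → AcceptsPadded D z)
  rec-AcceptsPadded =
    rec-× (rec-first (is-just ∘ proj₂) (cong is-just ∘ proj₂))
    (rec-× (rec-¬ (rec-pair (is-nothing ∘ proj₂) (cong is-nothing ∘ proj₂)
                            (is-just ∘ proj₂) (cong is-just ∘ proj₂)))
           (rec-∃ (finite-× (finite-Fin w) (finite-Fin w)) states image-states rec-IsRun))

  rec-IsODD : Recognisable (vecCoding (Layer A w) _≈L_) (λ k D → IsODD D)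
  rec-IsODD = rec-⇔
    (rec-× (rec-consecutive (finite-× S S) (λ B → ℓ B , r B) (λ (l , s , _) → cong₂ _,_ l s)
                            (λ (_ , s) (l , _) → ⌊ _≟_ S s l ⌋))
    (rec-× (rec-× (rec-first ι (λ (_ , _ , _ , _ , _ , i , _) → i))
                  -- Every position except the first is the right member of a consecutive pair, so a
                  -- relation ignoring its left argument checks exactly those positions. For `φ` the
                  -- left members are all positions except the last.
                  (rec-consecutive finite-Bool ι (λ (_ , _ , _ , _ , _ , i , _) → i) (λ _ b → not b)))
           (rec-× (rec-last φ (λ (_ , _ , _ , _ , _ , _ , f) → f))
                  (rec-consecutive finite-Bool φ (λ (_ , _ , _ , _ , _ , _ , f) → f) (λ b _ → not b)))))
    (λ k D →
      mk⇔ (λ c j → to (So-⌊⌋ (_≟_ S _ _)) (c j)) (λ c j → from (So-⌊⌋ (_≟_ S _ _)) (c j)) ×-⇔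
      only-first (λ j → ι (lookup D j)) ×-⇔ only-last (λ j → φ (lookup D j)))
    where
    S = finite-Subset w
    only-first : ∀ {k} (b : Fin (suc k) → Bool) → (So (b zero) × (∀ (j : Fin k) → So (not (b (suc j))))) ⇔
                 (∀ j → (b j ≡ true → j ≡ zero) × (j ≡ zero → b j ≡ true))
    only-first b = mk⇔
      (λ (x , y) → λ { zero → (λ _ → refl) , (λ _ → to T-≡ x)
                     ; (suc j) → (λ e → contradiction (from T-≡ e) (to (So-not _) (y j))) , (λ ()) })
      (λ f → from T-≡ (proj₂ (f zero) refl) ,
             λ j → from (So-not _) (λ x → case (proj₁ (f (suc j)) (to T-≡ x)) of λ ()))
    only-last : ∀ {k} (b : Fin (suc k) → Bool) → (So (b (fromℕ k)) × (∀ (j : Fin k) → So (not (b (inject₁ j))))) ⇔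
                (∀ j → (b j ≡ true → j ≡ fromℕ k) × (j ≡ fromℕ k → b j ≡ true))
    only-last {k} b = mk⇔
      (λ (x , y) j → last-only y j , λ { refl → to T-≡ x })
      (λ f → from T-≡ (proj₂ (f (fromℕ k)) refl) ,
             λ j → from (So-not _) (λ x → fromℕ≢inject₁ (sym (proj₁ (f (inject₁ j)) (to T-≡ x)))))
      where
      last-only : ∀ {k} {b : Fin (suc k) → Bool} → (∀ (j : Fin k) → So (not (b (inject₁ j)))) →
                  ∀ j → b j ≡ true → j ≡ fromℕ k
      last-only {zero}  y zero    e = refl
      last-only {suc k} y zero    e = contradiction (from T-≡ e) (to (So-not _) (y zero))
      last-only {suc k} y (suc j) e = cong suc (last-only (y ∘ suc) j e)

-- Tensor products

nothing? : {A : Set} (x : Maybe A) → Dec (x ≡ nothing)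
nothing? nothing  = yes refl
nothing? (just _) = no λ ()

-- The padding symbol of a tensor alphabet versus the tuple of padding symbols:
-- the latter never occurs in a tensor product.
pad : {A : Set} {a : ℕ} → Vec (Maybe A) a → Maybe (TLetter A a)
pad v with all? (λ i → nothing? (lookup v i))
... | yes _ = nothing
... | no  _ = just v

component : {A : Set} {a : ℕ} → Fin a → Maybe (TLetter A a) → Maybe A
component i nothing  = nothing
component i (just v) = lookup v i

component-pad : {A : Set} {a : ℕ} (i : Fin a) (v : Vec (Maybe A) a) → component i (pad v) ≡ lookup v i
component-pad i v with all? (λ i → nothing? (lookup v i))
... | yes e = sym (e i)
... | no  _ = refl

at-applyUpTo : {A : Set} (f : ℕ → A) {n j : ℕ} → j < n → at (applyUpTo f n) j ≡ just (f j)
at-applyUpTo f {suc n} {zero}  _       = refl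
at-applyUpTo f {suc n} {suc j} (s≤s l) = at-applyUpTo (f ∘ suc) l

foldr-⊔-tabulate : ∀ {a} (f : Fin a → ℕ) n → foldr _⊔_ 0 (tabulateL f) ≤ n ⇔ (∀ i → f i ≤ n)
foldr-⊔-tabulate {zero}  f n = mk⇔ (λ _ ()) (λ _ → z≤n)
foldr-⊔-tabulate {suc a} f n = mk⇔
  (λ l → λ { zero → m⊔n≤o⇒m≤o (f zero) _ l
           ; (suc i) → to (foldr-⊔-tabulate (f ∘ suc) n) (m⊔n≤o⇒n≤o (f zero) _ l) i })
  (λ g → ⊔-lub (g zero) (from (foldr-⊔-tabulate (f ∘ suc) n) (g ∘ suc)))

module _ {A : Set} {a : ℕ} (us : Fin a → List A) where

  maxLen-≤ : ∀ n → maxLen us ≤ n ⇔ (∀ i → length (us i) ≤ n)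
  maxLen-≤ n rewrite map-tabulate id (λ i → length (us i)) = foldr-⊔-tabulate (λ i → length (us i)) n

  tensor≡applyUpTo : tensor us ≡ applyUpTo (λ j → tabulate (λ i → at (us i) j)) (maxLen us)
  tensor≡applyUpTo = map-upTo _ (maxLen us)

  length-tensor : length (tensor us) ≡ maxLen us
  length-tensor = trans (cong length tensor≡applyUpTo) (length-applyUpTo _ (maxLen us))

  -- `maxLen` is the first position at which all components have ended, so the tensor string ends
  -- exactly where the tuple consists of padding only. Hence a padded tensor can be computed
  -- position by position.
  at-tensor : ∀ j → at (tensor us) j ≡ pad (tabulate (λ i → at (us i) j))
  at-tensor j with all? (λ i → nothing? (lookup (tabulate (λ i → at (us i) j)) i))
  ... | yes e = at-beyond (tensor us) (subst (_≤ j) (sym length-tensor)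
    (from (maxLen-≤ j) λ i → at-nothing (us i) (trans (sym (lookup∘tabulate _ i)) (e i))))
  ... | no ¬e = trans (cong (λ u → at u j) tensor≡applyUpTo)
    (at-applyUpTo _ (≰⇒> λ l → ¬e λ i → trans (lookup∘tabulate _ i) (at-beyond (us i) (to (maxLen-≤ j) l i))))

module _ {A : Set} {w k : ℕ} (D : Vec (Layer A w) (suc k)) {a : ℕ} where

  length-tensor-≤ : (us : Fin a → List A) → (∀ i → Accepts D (us i)) → length (tensor us) ≤ suc k
  length-tensor-≤ us acc = subst (_≤ suc k) (sym (length-tensor us))
    (from (maxLen-≤ us (suc k)) λ i → proj₁ (proj₂ (acc i)))

  -- The factors of `u` are forced to be its unpadded components, so no search over tuples of
  -- strings remains. The second condition forbids letters made of padding only: with one of them at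
  -- its end, `u` would be longer than the tensor of its components.
  inTensorPow⇔ : (u : List (TLetter A a)) → length u ≤ suc k →
    ((∀ i → AcceptsPadded D (λ j → component i (at u (toℕ j)))) ×
     (∀ (j : Fin (suc k)) → pad (tabulate (λ i → component i (at u (toℕ j)))) ≡ at u (toℕ j)))
    ⇔ InTensorPow (Accepts D) a u
  inTensorPow⇔ u l = mk⇔
    (λ (acc , tight) →
      let d = λ i → to (accepted-image D _) (acc i)
          us = λ i → proj₁ (proj₁ (d i))
          us-acc = λ i → proj₂ (proj₁ (d i))
      in us , us-acc , at-ext (suc k) u (tensor us) l (length-tensor-≤ us us-acc) λ j →
           trans (sym (tight j)) (trans (cong pad (tabulate-cong λ i → sym (proj₂ (d i) j))) (sym (at-tensor us (toℕ j)))))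
    λ { (us , acc , refl) →
      let at-component = λ i j → trans (cong (component i) (at-tensor us j))
                           (trans (component-pad i (tabulate (λ i → at (us i) j))) (lookup∘tabulate (λ i → at (us i) j) i))
      in (λ i → acceptsPadded-cong D (λ j → sym (at-component i (toℕ j)))
                 (to (accepts⇔padded D (us i) (proj₁ (proj₂ (acc i)))) (acc i))) ,
         λ j → trans (cong pad (tabulate-cong λ i → at-component i (toℕ j))) (sym (at-tensor us (toℕ j))) }

-- Structural tuples and derived structures

module _ {s w m : ℕ} (τ : Vec ℕ m) where

  private
    Γ = BLetter s w τ

    _∼_ : Γ → Γ → Set
    _∼_ = _≈B_ {τ = τ}

    Strings : Coding
    Strings = vecCoding Γ _∼_

    fin-TLetter : ∀ a → Finite (TLetter (Fin s) a)
    fin-TLetter = finite-Vec (finite-Maybe (finite-Fin s))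

  ≈B-refl : (x : Γ) → x ∼ x
  ≈B-refl x = ≈L-refl {B = proj₁ x} , λ i → ≈L-refl {B = proj₂ x i}

  ≈B-isDec : IsDecEquivalence _∼_
  ≈B-isDec = record
    { isEquivalence = record
      { refl = λ {x} → ≈B-refl x
      ; sym = λ {x} {y} (e , f) → ≈L-sym {B = proj₁ x} {proj₁ y} e , λ i → ≈L-sym {B = proj₂ x i} {proj₂ y i} (f i)
      ; trans = λ {x} {y} {z} (e , f) (e′ , f′) → ≈L-trans {B = proj₁ x} {proj₁ y} {proj₁ z} e e′ ,
                  λ i → ≈L-trans {B = proj₂ x i} {proj₂ y i} {proj₂ z i} (f i) (f′ i) }
    ; _≟_ = λ x y → _≈L?_ (finite-Fin s) (proj₁ x) (proj₁ y) ×-dec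
                    all? λ i → _≈L?_ (fin-TLetter (lookup τ i)) (proj₂ x i) (proj₂ y i) }

  search-BLetter : Searchable Γ _∼_
  search-BLetter = search-× (λ {B} → ≈L-refl {B = B}) (λ {f} i → ≈L-refl {B = f i})
    (search-Layer (finite-Fin s)) (search-Π m (λ {_} {B} → ≈L-refl {B = B}) (λ i → search-Layer (fin-TLetter (lookup τ i))))

  lookup-comp₀ : ∀ {k} (D : Vec Γ (suc k)) j → lookup (comp₀ {τ = τ} D) j ≈L proj₁ (lookup D j)
  lookup-comp₀ D j = ≈L-reflexive (lookup-map j proj₁ D)

  lookup-compᵢ : ∀ {k} (D : Vec Γ (suc k)) i j → lookup (compᵢ {τ = τ} D i) j ≈L proj₂ (lookup D j) i
  lookup-compᵢ D i j = ≈L-reflexive (lookup-map j (λ x → proj₂ x i) D)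

  trackCoding : Set → Coding
  trackCoding A = withFreeTrack Strings (Maybe A)

  rec-accepts₀ : Recognisable (trackCoding (Fin s)) (λ k (D , z) → AcceptsPadded (comp₀ {τ = τ} D) z)
  rec-accepts₀ = pullback (λ (D , z) → comp₀ {τ = τ} D , z) (λ (c , x) → proj₁ x , c)
    (λ (e , f , _) → f , e) (λ (D , z) j → lookup-comp₀ D j , refl) rec-AcceptsPadded

  rec-acceptsᵢ : ∀ i → Recognisable (trackCoding (TLetter (Fin s) (lookup τ i)))
                         (λ k (D , z) → AcceptsPadded (compᵢ {τ = τ} D i) z)
  rec-acceptsᵢ i = pullback (λ (D , z) → compᵢ {τ = τ} D i , z) (λ (c , x) → proj₂ x i , c)
    (λ (e , _ , f) → f i , e) (λ (D , z) j → lookup-compᵢ D i j , refl) rec-AcceptsPadded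

  -- String and acceptance proof are bundled into one quantified value; the proof supplies the
  -- length bound that `inTensorPow⇔` needs.
  rec-inTensorPow : ∀ i → Recognisable Strings (λ k D →
    ∀ (d : Σ (List (TLetter (Fin s) (lookup τ i))) (Accepts (compᵢ {τ = τ} D i))) →
    InTensorPow (Accepts (comp₀ {τ = τ} D)) (lookup τ i) (proj₁ d))
  rec-inTensorPow i = rec-∀ fin (λ D (u , _) j → at u (toℕ j))
    (rec-⇔ (rec-acceptsᵢ i) (λ k (D , z) → accepted-image (compᵢ {τ = τ} D i) z))
    (rec-⇔
      (rec-× (rec-∀Fin (lookup τ i) λ l → pullback
               (λ (D , u , _) → D , λ j → component l (at u (toℕ j))) (λ (c , x) → component l c , x)
               (λ (e , f) → cong (component l) e , f) (λ (D , _) j → refl , ≈B-refl (lookup D j))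
               rec-accepts₀)
             (rec-all (λ (c , _) → tight? c) (λ (e , _) → cong tight? e)))
      λ k (D , u , acc) → inTensorPow⇔ (comp₀ {τ = τ} D) u (proj₁ (proj₂ acc)) ⇔-∘
        (mk⇔ id id ×-⇔ mk⇔ (λ f j → to (So-⌊⌋ (_≟_ fin _ _)) (f j)) (λ f j → from (So-⌊⌋ (_≟_ fin _ _)) (f j))))
    where
    fin = finite-Maybe (fin-TLetter (lookup τ i))
    tight? : Maybe (TLetter (Fin s) (lookup τ i)) → Bool
    tight? c = ⌊ _≟_ fin (pad (tabulate (λ l → component l c))) c ⌋

  rec-Structural : Recognisable Strings (λ k D → Structural τ D)
  rec-Structural =
    rec-× (pullback (comp₀ {τ = τ}) proj₁ proj₁ lookup-comp₀ rec-IsODD)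
    (rec-× (rec-∀Fin m λ i → pullback (λ D → compᵢ {τ = τ} D i) (λ x → proj₂ x i) (λ e → proj₂ e i)
              (λ D → lookup-compᵢ D i) rec-IsODD)
           (rec-∀Fin m λ i → rec-⇔ (rec-inTensorPow i)
              (λ k D → mk⇔ (λ f u acc → f (u , acc)) (λ f (u , acc) → f u acc))))

  -- The elements belong to the structure derived from `D`, so the type of assignments depends on
  -- the string being read, whereas the letters do not.
  foCoding : ℕ → Coding
  foCoding n = record
    { Env = λ k → Σ (Vec Γ (suc k)) λ D → Fin n → Dom (DerivedStructure τ D)
    ; Letter = Γ × (Fin n → Maybe (Fin s))
    ; _≈_ = λ (x , t) (x′ , t′) → x ∼ x′ × t ≗ t′
    ; word = λ (D , ρ) j → lookup D j , λ i → at (proj₁ (ρ i)) (toℕ j) }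

  image-element : ∀ {n} → Recognisable (withFreeTrack (foCoding n) (Maybe (Fin s)))
    (λ k ((D , _) , z) → Σ (Dom (DerivedStructure τ D)) λ d → ∀ j → at (proj₁ d) (toℕ j) ≡ z j)
  image-element = rec-⇔
    (pullback (λ ((D , _) , z) → D , z) (λ (c , x , _) → c , x) (λ (e , f , _) → e , f)
              (λ ((D , _) , _) j → refl , ≈B-refl (lookup D j)) rec-accepts₀)
    (λ k ((D , _) , z) → accepted-image (comp₀ {τ = τ} D) z)

  bind-element : ∀ {n P} → Recognisable (foCoding (suc n)) P →
    Recognisable (withTrack (foCoding n) (λ (D , _) → Dom (DerivedStructure τ D)) (λ _ d j → at (proj₁ d) (toℕ j)))
                 (λ k ((D , ρ) , d) → P k (D , extend d ρ))
  bind-element = pullback (λ ((D , ρ) , d) → D , extend d ρ) (λ (c , x , t) → x , extend c t)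
    (λ (e , f , g) → f , (λ { zero → e ; (suc i) → g i }))
    (λ ((D , _) , _) j → ≈B-refl (lookup D j) , λ { zero → refl ; (suc i) → refl })

  rec-FO : ∀ {n} (f : FO τ n) → Recognisable (foCoding n) (λ k (D , ρ) → SatFO (DerivedStructure τ D) ρ f)
  rec-FO (rel i xs) = rec-⇔
    (pullback
      (λ (D , ρ) → D , λ j → at (tensor (λ l → proj₁ (ρ (xs l)))) (toℕ j))
      -- By `at-tensor` this is the padded tensor of the chosen elements, assembled from their
      -- tracks.
      (λ (x , t) → pad (tabulate (λ l → t (xs l))) , x)
      (λ (e , f) → cong pad (tabulate-cong λ l → f (xs l)) , e)
      (λ (D , ρ) j → at-tensor (λ l → proj₁ (ρ (xs l))) (toℕ j) , ≈B-refl (lookup D j))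
      (rec-acceptsᵢ i))
    (λ k (D , ρ) → ⇔-sym (accepts⇔padded (compᵢ {τ = τ} D i) (tensor (λ l → proj₁ (ρ (xs l))))
      -- Domain elements are accepted by the ODD for the domain, which has the same length as the
      -- one for relation `i`; this bounds their tensor.
      (length-tensor-≤ (comp₀ {τ = τ} D) (λ l → proj₁ (ρ (xs l))) (λ l → proj₂ (ρ (xs l))))))
  rec-FO (eq x y) = rec-⇔
    (rec-all (λ (_ , t) → ⌊ _≟_ fin (t x) (t y) ⌋) (λ (_ , f) → cong₂ (λ a b → ⌊ _≟_ fin a b ⌋) (f x) (f y)))
    (λ k (D , ρ) → mk⇔
      (λ f → at-ext (suc k) (proj₁ (ρ x)) (proj₁ (ρ y)) (proj₁ (proj₂ (proj₂ (ρ x)))) (proj₁ (proj₂ (proj₂ (ρ y))))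
               (λ j → to (So-⌊⌋ (_≟_ fin _ _)) (f j)))
      (λ e j → from (So-⌊⌋ (_≟_ fin _ _)) (cong (λ u → at u (toℕ j)) e)))
    where fin = finite-Maybe (finite-Fin s)
  rec-FO (neg f)   = rec-¬ (rec-FO f)
  rec-FO (and f g) = rec-× (rec-FO f) (rec-FO g)
  rec-FO (or f g)  = rec-⊎ (rec-FO f) (rec-FO g)
  rec-FO (ex f)    = rec-∃ (finite-Maybe (finite-Fin s)) _ image-element (bind-element (rec-FO f))
  rec-FO (all f)   = rec-∀ (finite-Maybe (finite-Fin s)) _ image-element (bind-element (rec-FO f))

  rec-FO-sentence : (f : FO τ 0) (ρ : ∀ {k} (D : Vec Γ (suc k)) → Fin 0 → Dom (DerivedStructure τ D)) →
                    Recognisable Strings (λ k D → SatFO (DerivedStructure τ D) (ρ D) f)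
  rec-FO-sentence f ρ = pullback (λ D → D , ρ D) (λ x → x , (λ ())) (λ e → e , (λ ()))
    (λ D j → ≈B-refl (lookup D j) , (λ ())) (rec-FO f)

theorem3 : (s w : ℕ) → 1 ≤ w → (m : ℕ) (τ : Vec ℕ m)
    → (ψ : MSO (BLetter s w τ) 0 0) (φ : FO τ 0)
    → Dec (Σ ℕ λ k → Σ (Vec (BLetter s w τ) (suc k)) λ D →
    Structural τ D × Models-MSO τ D ψ × (DerivedStructure τ D ⊨FO φ))
theorem3 s w _ m τ ψ φ = nonempty? (λ {x} {y} → IsDecEquivalence.sym (≈B-isDec τ) {x} {y}) (search-BLetter τ)
  (rec-× (rec-Structural τ)
  (rec-× (rec-MSO-sentence (≈B-isDec τ) ψ _ _) (rec-FO-sentence τ φ _)))
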